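{- The randomized online algorithm $\textsc{Random-Push}$ is dynamically optimal in expectation: there is a constant $c$ such that for every request sequence $\sigma$ (chosen by an oblivious adversary), $\mathbb{E}[\mathrm{cost}(\textsc{Random-Push}(\sigma))] \le c\cdot \mathrm{cost}(\textsc{Opt}(\sigma))$.
   Context: Self-adjusting complete tree model: a set $V$ of $n$ items is stored in a complete binary tree of $n$ servers, one item per server; the root has depth $0$ and an item's depth is that of its hosting server. Requests $\sigma=(\sigma^{(1)},\sigma^{(2)},\dots)$ to items are revealed online and originate at the root. Serving a request to an item at depth $d$ costs $d$ (access cost); a swap, exchanging the items of a server and its parent, costs $1$ (adjustment cost); the cost of an algorithm on $\sigma$ is the total of access and adjustment costs. $\textsc{Opt}$ denotes an optimal offline algorithm that knows $\sigma$ in advance. The adversary is oblivious: $\sigma$ is fixed independently of the algorithm's random bits. Algorithm $\textsc{Random-Push}$: upon a request to item $u$ hosted at server $s$ of depth $k$, it accesses $u$, moves $u$ to the root, and pushes the previous root item $v$ down along a random path starting at the root, where at each step one of the two children of the current server is chosen uniformly at random, for $k$ steps: each item on this path down to depth $k-1$ moves down one level to the next server on the path. The item $w$ that was hosted at the end of the path (at depth $k$) is then moved to the server $s$. The whole operation is implemented by swaps of cost $O(k)$. -}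

module Defs where

open import Data.Nat using (ℕ; zero; suc; _+_; _*_; _≤_; _<_; _<?_)
open import Data.Bool using (Bool; true; false)
import Data.Bool.Properties as BoolP
open import Data.Fin using (Fin; _≟_)
open import Data.List using (List; []; _∷_; length; take; map; concatMap; _∷ʳ_)
open import Data.List.Properties using (≡-dec)
open import Data.Vec using (Vec; []; _∷_; toList)
open import Data.Product using (_×_; ∃-syntax)
open import Relation.Nullary using (Dec; yes; no)
open import Relation.Binary.PropositionalEquality using (_≡_)

-- Servers of the complete binary tree of height H are addressed by their
-- root-to-server path: a list of bits (false = left child, true = right
-- child), head = first step from the root.  The depth of a server is the
-- length of its address; valid addresses are those of length ≤ H.
Addr : Set
Addr = List Bool

_≟A_ : (a b : Addr) → Dec (a ≡ b)
_≟A_ = ≡-dec BoolP._≟_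

-- A configuration of items Fin m: the address of the server hosting each item.
Loc : ℕ → Set
Loc m = Fin m → Addr

-- loc is a valid placement of the m items on the complete binary tree of
-- height H: every item sits at a server, one item per server, every server
-- hosts an item (hence m = 2^(H+1) - 1).
IsPlacement : ∀ {m} → ℕ → Loc m → Set
IsPlacement {m} H loc =
  (∀ x → length (loc x) ≤ H) ×
  (∀ x y → loc x ≡ loc y → x ≡ y) ×
  (∀ (a : Addr) → length a ≤ H → ∃[ x ] loc x ≡ a)

depth : ∀ {m} → Loc m → Fin m → ℕ
depth loc x = length (loc x)

-- New address of an item (different from the requested item u) currently at
-- address a, when u was at address s of depth k and path is the random path
-- of length k.  Items at depth j < k on the path move one step down the
-- path; the item at the end of the path moves to s; others stay.
pushMove′ : (k : ℕ) (s path a : Addr) → Dec (a ≡ path) → Addr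
pushMove′ k s path a (yes _) = s
pushMove′ k s path a (no _)  = a

pushMove : (k : ℕ) (s path a : Addr) → Addr
pushMove k s path a with length a <? k | a ≟A take (length a) path
... | yes _ | yes _ = take (suc (length a)) path
... | _     | _     = pushMove′ k s path a (a ≟A path)

-- One Random-Push step serving a request to u, with random bits r: the
-- random path consists of the first k bits of r, where k is the depth of u
-- (each bit is a uniform independent choice of a child).
rpStep : ∀ {m H} → Loc m → Fin m → Vec Bool H → Loc m
rpStep loc u r x with x ≟ u
... | yes _ = []
... | no _  = pushMove (depth loc u) (loc u) (take (depth loc u) (toList r)) (loc x)

-- Adjustment (swap) cost charged to Random-Push for a request at depth k:
-- the operation is implemented by O(k) swaps; we charge 4k.
rpAdjust : ℕ → ℕ
rpAdjust k = 4 * k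

rpCost : ∀ {m} (H : ℕ) → Loc m → (σ : List (Fin m)) → Vec (Vec Bool H) (length σ) → ℕ
rpCost H loc []      []       = 0
rpCost H loc (u ∷ σ) (r ∷ rs) =
  depth loc u + rpAdjust (depth loc u) + rpCost H (rpStep loc u r) σ rs

allVecs : ∀ {A : Set} → List A → (k : ℕ) → List (Vec A k)
allVecs xs zero    = [] ∷ []
allVecs xs (suc k) = concatMap (λ x → map (x ∷_) (allVecs xs k)) xs

outcomes : (H ℓ : ℕ) → List (Vec (Vec Bool H) ℓ)
outcomes H ℓ = allVecs (allVecs (true ∷ false ∷ []) H) ℓ

sumL : List ℕ → ℕ
sumL []       = 0
sumL (x ∷ xs) = x + sumL xs

-- Sum over all outcomes of Random-Push's cost
-- (= expected cost × number of outcomes).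
rpTotal : ∀ {m} (H : ℕ) → Loc m → (σ : List (Fin m)) → ℕ
rpTotal H loc σ = sumL (map (rpCost H loc σ) (outcomes H (length σ)))

-- A swap of the server  parent ∷ʳ dir  with its parent server  parent.
record Swap (H : ℕ) : Set where
  constructor swap
  field
    parent : Addr
    dir    : Bool
    inTree : length parent < H

applySwap : ∀ {m H} → Swap H → Loc m → Loc m
applySwap (swap p b _) loc x with loc x ≟A p | loc x ≟A (p ∷ʳ b)
... | yes _ | _     = p ∷ʳ b
... | no _  | yes _ = p
... | no _  | no _  = loc x

applySwaps : ∀ {m H} → List (Swap H) → Loc m → Loc m
applySwaps []       loc = loc
applySwaps (s ∷ ss) loc = applySwaps ss (applySwap s loc)

-- An arbitrary offline algorithm: before serving each request it performs an
-- arbitrary sequence of swaps.  Its cost: number of swaps plus access costs.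
offCost : ∀ {m H} → Loc m → (σ : List (Fin m)) → Vec (List (Swap H)) (length σ) → ℕ
offCost loc []      []         = 0
offCost loc (u ∷ σ) (ss ∷ sss) =
  length ss + depth (applySwaps ss loc) u + offCost (applySwaps ss loc) σ sss

{-# OPTIONS --safe #-}

-- Amortized analysis with the potential Φ = ∑ φ (depth in Random-Push, depth in
-- the offline tree).  A push lowers the item at depth j with probability 2 ^ -j,
-- and φ then grows only if j is about four times the offline depth o or more;
-- since the offline tree has 2 ^ o items at depth o, the expected growth of Φ is
-- bounded by a constant.  The requested item loses its credit when moved to the
-- root, which pays for the access, for the push, and for that constant, up to a
-- multiple of its offline depth; an offline swap raises Φ by at most 4.
-- Expectations are sums over all 2 ^ H bit vectors, and the weights 8 ^ -o are
-- scaled by 8 ^ H.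

module Submission where

open import Defs
open import Data.Bool using (Bool; true; false)
open import Data.Nat using (ℕ; zero; suc; _+_; _*_; _∸_; _^_; _≤_; _<_; _<?_; _≤?_; z≤n; s≤s)
open import Data.Nat.Properties hiding (_≟_; suc-injective)
open import Data.Nat.Tactic.RingSolver using (solve-∀)
open import Data.Fin using (Fin; zero; suc; _≟_)
open import Data.Fin.Properties using (any?; suc-injective)
open import Data.List using (List; []; _∷_; _++_; _∷ʳ_; length; map; concatMap; take; drop; tabulate)
open import Data.List.Properties using (length-++; length-take; take-take)
open import Data.List.Relation.Unary.All using (All; []; _∷_)
import Data.List.Relation.Unary.All.Properties as All
open import Data.List.Relation.Unary.AllPairs using ([]; _∷_)
open import Data.List.Relation.Unary.Unique.Propositional using (Unique)
import Data.List.Relation.Unary.Unique.Propositional.Properties as Unique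
open import Data.Vec using (Vec; []; _∷_; toList)
import Data.Vec.Properties as Vec
open import Data.Product using (_×_; _,_; ∃-syntax; proj₁; proj₂)
open import Data.Sum using (_⊎_; inj₁; inj₂)
open import Function using (_∘_; const)
open import Relation.Nullary using (Dec; yes; no; contradiction)
open import Relation.Binary.PropositionalEquality
  using (_≡_; _≢_; refl; sym; trans; cong; cong₂; subst; _≗_; module ≡-Reasoning)
open import Algebra.Properties.Semiring.Sum +-*-semiring
  using (sum; ∑-distrib-+; *-distribˡ-sum)

-- Sums

sum-0 : ∀ m → sum {m} (const 0) ≡ 0
sum-0 zero    = refl
sum-0 (suc m) = sum-0 m

total : {A : Set} → (A → ℕ) → List A → ℕ
total f xs = sumL (map f xs)

module _ {A : Set} where

  total-mono : {f g : A → ℕ} → (∀ x → f x ≤ g x) → ∀ xs → total f xs ≤ total g xs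
  total-mono f≤g []       = z≤n
  total-mono f≤g (x ∷ xs) = +-mono-≤ (f≤g x) (total-mono f≤g xs)

  total-cong : {f g : A → ℕ} → f ≗ g → total f ≗ total g
  total-cong f≗g []       = refl
  total-cong f≗g (x ∷ xs) = cong₂ _+_ (f≗g x) (total-cong f≗g xs)

  total-const : ∀ c (xs : List A) → total (const c) xs ≡ length xs * c
  total-const c []       = refl
  total-const c (x ∷ xs) = cong (c +_) (total-const c xs)

  total-+ : ∀ (f g : A → ℕ) xs → total (λ x → f x + g x) xs ≡ total f xs + total g xs
  total-+ f g []       = refl
  total-+ f g (x ∷ xs) rewrite total-+ f g xs =
    interchange (f x) (g x) (total f xs) (total g xs)
    where
    interchange : ∀ a b c d → a + b + (c + d) ≡ a + c + (b + d)
    interchange = solve-∀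

  total-* : ∀ (f : A → ℕ) c xs → total (λ x → f x * c) xs ≡ total f xs * c
  total-* f c []       = refl
  total-* f c (x ∷ xs) rewrite total-* f c xs = sym (*-distribʳ-+ c (f x) (total f xs))

  total-++ : ∀ (f : A → ℕ) xs ys → total f (xs ++ ys) ≡ total f xs + total f ys
  total-++ f []       ys = refl
  total-++ f (x ∷ xs) ys rewrite total-++ f xs ys = sym (+-assoc (f x) _ _)

  total-sum : ∀ {m} (f : A → Fin m → ℕ) xs →
    total (λ x → sum (f x)) xs ≡ sum (λ e → total (λ x → f x e) xs)
  total-sum {m} f [] = sym (sum-0 m)
  total-sum f (x ∷ xs) rewrite total-sum f xs = sym (∑-distrib-+ (f x) _)

total-map : {A B : Set} (f : B → ℕ) (g : A → B) (xs : List A) → total f (map g xs) ≡ total (f ∘ g) xs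
total-map f g []       = refl
total-map f g (x ∷ xs) = cong (f (g x) +_) (total-map f g xs)

total-concatMap : {A B : Set} (f : B → ℕ) (g : A → List B) (xs : List A) →
  total f (concatMap g xs) ≡ total (λ x → total f (g x)) xs
total-concatMap f g []       = refl
total-concatMap f g (x ∷ xs) =
  trans (total-++ f (g x) _) (cong (total f (g x) +_) (total-concatMap f g xs))

-- Conditions on the first coordinate: the first bit of a path in `total-visits`, the bits of the
-- first request in `rpTotal-bound`.
total-allVecs : {A : Set} (xs : List A) (k : ℕ) (f : Vec A (suc k) → ℕ) →
  total f (allVecs xs (suc k)) ≡ total (λ x → total (λ v → f (x ∷ v)) (allVecs xs k)) xs
total-allVecs xs k f =
  trans (total-concatMap f (λ x → map (x ∷_) (allVecs xs k)) xs)
        (total-cong (λ x → total-map f (x ∷_) (allVecs xs k)) xs)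

length-allVecs : {A : Set} (xs : List A) (k : ℕ) →
  length (allVecs xs (suc k)) ≡ length xs * length (allVecs xs k)
length-allVecs {A} xs k = begin
  length (allVecs xs (suc k))                               ≡⟨ total-1 (allVecs xs (suc k)) ⟨
  total (const 1) (allVecs xs (suc k))                      ≡⟨ total-allVecs xs k (const 1) ⟩
  total (const (total (const 1) (allVecs xs k))) xs         ≡⟨ total-const _ xs ⟩
  length xs * total (const 1) (allVecs xs k)                ≡⟨ cong (length xs *_) (total-1 (allVecs xs k)) ⟩
  length xs * length (allVecs xs k)                         ∎
  where
  open ≡-Reasoning
  total-1 : {B : Set} (ys : List B) → total (const 1) ys ≡ length ys
  total-1 ys = trans (total-const 1 ys) (*-identityʳ _)

sum-mono : ∀ {m} {f g : Fin m → ℕ} → (∀ e → f e ≤ g e) → sum f ≤ sum g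
sum-mono {zero}  f≤g = z≤n
sum-mono {suc m} f≤g = +-mono-≤ (f≤g zero) (sum-mono (f≤g ∘ suc))

-- One item needs separate accounting: the requested one, whose credit pays for the step, or the one
-- lifted by an offline swap. The slacks `a` and `b` carry what it pays and receives.
sum-mono-except : ∀ {m} {f g : Fin m → ℕ} (u : Fin m) {a b : ℕ} →
  (∀ e → e ≢ u → f e ≤ g e) → f u + a ≤ g u + b → sum f + a ≤ sum g + b
sum-mono-except {f = f} {g} zero {a} {b} f≤g fu≤gu = begin
  f zero + sum (f ∘ suc) + a    ≡⟨ swapʳ (f zero) _ a ⟩
  f zero + a + sum (f ∘ suc)    ≤⟨ +-mono-≤ fu≤gu (sum-mono (λ e → f≤g (suc e) λ ())) ⟩
  g zero + b + sum (g ∘ suc)    ≡⟨ swapʳ (g zero) b _ ⟩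
  g zero + sum (g ∘ suc) + b    ∎
  where
  open ≤-Reasoning
  swapʳ : ∀ x y z → x + y + z ≡ x + z + y
  swapʳ = solve-∀
sum-mono-except {f = f} {g} (suc u) {a} {b} f≤g fu≤gu = begin
  f zero + sum (f ∘ suc) + a    ≡⟨ +-assoc (f zero) _ a ⟩
  f zero + (sum (f ∘ suc) + a)  ≤⟨ +-mono-≤ (f≤g zero λ ())
                                     (sum-mono-except u (λ e e≢u → f≤g (suc e) (e≢u ∘ suc-injective)) fu≤gu) ⟩
  g zero + (sum (g ∘ suc) + b)  ≡⟨ +-assoc (g zero) _ b ⟨
  g zero + sum (g ∘ suc) + b    ∎
  where open ≤-Reasoning

-- The probability that a random path visits a given server

bits : List Bool
bits = true ∷ false ∷ []

-- Indicator of the event that the walk steered by `r` passes through the server; a number, so that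
-- summing over all `r` counts the favourable outcomes.
visits : Addr → ∀ {n} → Vec Bool n → ℕ
visits []          r           = 1
visits (_ ∷ _)     []          = 0
visits (true ∷ a)  (true ∷ r)  = visits a r
visits (false ∷ a) (false ∷ r) = visits a r
visits (true ∷ a)  (false ∷ r) = 0
visits (false ∷ a) (true ∷ r)  = 0

visits-take : ∀ a {n} (r : Vec Bool n) → a ≡ take (length a) (toList r) → visits a r ≡ 1
visits-take []          r           _  = refl
visits-take (_ ∷ _)     []          ()
visits-take (true ∷ a)  (true ∷ r)  eq = visits-take a r (cong (drop 1) eq)
visits-take (false ∷ a) (false ∷ r) eq = visits-take a r (cong (drop 1) eq)
visits-take (true ∷ a)  (false ∷ r) ()
visits-take (false ∷ a) (true ∷ r)  ()

-- Each step of the address agrees with half of the bit vectors. Equality fails for an address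
-- longer than `n`, which no walk reaches.
total-visits : ∀ a n → total (visits a) (allVecs bits n) * 2 ^ length a ≤ length (allVecs bits n)
total-visits [] n = ≤-reflexive (begin
  total (const 1) (allVecs bits n) * 1  ≡⟨ *-identityʳ _ ⟩
  total (const 1) (allVecs bits n)      ≡⟨ total-const 1 (allVecs bits n) ⟩
  length (allVecs bits n) * 1           ≡⟨ *-identityʳ _ ⟩
  length (allVecs bits n)               ∎)
  where open ≡-Reasoning
total-visits (_ ∷ _) zero = z≤n
total-visits (b ∷ a) (suc n) = begin
  total (visits (b ∷ a)) (allVecs bits (suc n)) * (2 * 2 ^ length a)
    ≡⟨ cong (_* (2 * 2 ^ length a)) (trans (total-allVecs bits n (visits (b ∷ a))) (halves b)) ⟩
  t * (2 * 2 ^ length a)         ≡⟨ x*[2*y] t (2 ^ length a) ⟩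
  2 * (t * 2 ^ length a)         ≤⟨ *-monoʳ-≤ 2 (total-visits a n) ⟩
  2 * length (allVecs bits n)    ≡⟨ length-allVecs bits n ⟨
  length (allVecs bits (suc n))  ∎
  where
  open ≤-Reasoning
  t = total (visits a) (allVecs bits n)
  x*[2*y] : ∀ x y → x * (2 * y) ≡ 2 * (x * y)
  x*[2*y] = solve-∀
  total-0 : total (const 0) (allVecs bits n) ≡ 0
  total-0 = trans (total-const 0 (allVecs bits n)) (*-zeroʳ (length (allVecs bits n)))
  halves : ∀ b → total (λ c → total (λ v → visits (b ∷ a) (c ∷ v)) (allVecs bits n)) bits ≡ t
  halves true  rewrite total-0 = +-identityʳ t
  halves false rewrite total-0 = +-identityʳ t

-- Kraft's inequality

-- Readdressing relative to the child lets Kraft's inequality recurse on the height.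
childAddrs : Bool → List Addr → List Addr
childAddrs b []                 = []
childAddrs b ([] ∷ as)          = childAddrs b as
childAddrs true  ((true ∷ a) ∷ as)  = a ∷ childAddrs true as
childAddrs true  ((false ∷ a) ∷ as) = childAddrs true as
childAddrs false ((true ∷ a) ∷ as)  = childAddrs false as
childAddrs false ((false ∷ a) ∷ as) = a ∷ childAddrs false as

childAddrs-All : ∀ {P Q : Addr → Set} b → (∀ {a} → P (b ∷ a) → Q a) →
  ∀ {as} → All P as → All Q (childAddrs b as)
childAddrs-All b P⇒Q []                               = []
childAddrs-All b P⇒Q (_∷_ {[]} _ ps)                  = childAddrs-All b P⇒Q ps
childAddrs-All true  P⇒Q (_∷_ {true ∷ a} p ps)        = P⇒Q p ∷ childAddrs-All true P⇒Q ps
childAddrs-All true  P⇒Q (_∷_ {false ∷ a} p ps)       = childAddrs-All true P⇒Q ps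
childAddrs-All false P⇒Q (_∷_ {true ∷ a} p ps)        = childAddrs-All false P⇒Q ps
childAddrs-All false P⇒Q (_∷_ {false ∷ a} p ps)       = P⇒Q p ∷ childAddrs-All false P⇒Q ps

childAddrs-Unique : ∀ b {as} → Unique as → Unique (childAddrs b as)
childAddrs-Unique b []                             = []
childAddrs-Unique b (_∷_ {[]} _ us)                = childAddrs-Unique b us
childAddrs-Unique true  (_∷_ {true ∷ a} ≢as us)    =
  childAddrs-All true (λ ≢b → ≢b ∘ cong (true ∷_)) ≢as ∷ childAddrs-Unique true us
childAddrs-Unique true  (_∷_ {false ∷ a} _ us)     = childAddrs-Unique true us
childAddrs-Unique false (_∷_ {true ∷ a} _ us)      = childAddrs-Unique false us
childAddrs-Unique false (_∷_ {false ∷ a} ≢as us)   =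
  childAddrs-All false (λ ≢b → ≢b ∘ cong (false ∷_)) ≢as ∷ childAddrs-Unique false us

isRoot : Addr → ℕ
isRoot []      = 1
isRoot (_ ∷ _) = 0

total-isRoot : ∀ {as} → Unique as → total isRoot as ≤ 1
total-isRoot [] = z≤n
total-isRoot (_∷_ {[]} ≢as us) = ≤-reflexive (cong suc (noRoot ≢as))
  where
  noRoot : ∀ {as} → All ([] ≢_) as → total isRoot as ≡ 0
  noRoot []                  = refl
  noRoot (_∷_ {[]} ≢[] _)    = contradiction refl ≢[]
  noRoot (_∷_ {_ ∷ _} _ ps)  = noRoot ps
total-isRoot (_∷_ {_ ∷ _} _ us) = total-isRoot us

total-by-root : ∀ (f : Addr → ℕ) as →
  total f as ≡ total isRoot as * f [] +
    (total (f ∘ (true ∷_)) (childAddrs true as) + total (f ∘ (false ∷_)) (childAddrs false as))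
total-by-root f [] = refl
total-by-root f ([] ∷ as) rewrite total-by-root f as = sym (+-assoc (f []) _ _)
total-by-root f ((true ∷ a) ∷ as) rewrite total-by-root f as = left (f (true ∷ a)) (total isRoot as * f []) _ _
  where
  left : ∀ x y z w → x + (y + (z + w)) ≡ y + (x + z + w)
  left = solve-∀
total-by-root f ((false ∷ a) ∷ as) rewrite total-by-root f as = right (f (false ∷ a)) (total isRoot as * f []) (total (f ∘ (true ∷_)) (childAddrs true as)) _
  where
  right : ∀ x y z w → x + (y + (z + w)) ≡ y + (z + (x + w))
  right = solve-∀

-- `weight (suc h) (b ∷ a)` reduces to `weight h a`, so the totals of the subtrees need no rescaling
-- in the induction.
weight : ℕ → Addr → ℕ
weight h a = 8 ^ (h ∸ length a)

-- At most 2 ^ d addresses have length d, and ∑ 2 ^ d / 8 ^ d = 4 / 3.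
kraft : ∀ h {as} → Unique as → All (λ a → length a ≤ h) as → 3 * total (weight h) as ≤ 4 * 8 ^ h
kraft zero {as} us short = begin
  3 * total (weight 0) as            ≡⟨ cong (3 *_) (trans (total-cong (λ a → cong (8 ^_) (0∸n≡0 (length a))) as)
                                                      (total-const 1 as)) ⟩
  3 * (length as * 1)                ≡⟨ cong (λ n → 3 * n) (trans (*-identityʳ _) (allRoots short)) ⟩
  3 * total isRoot as                ≤⟨ *-mono-≤ {3} {4} (n≤1+n 3) (total-isRoot us) ⟩
  4 * 1                              ∎
  where
  open ≤-Reasoning
  allRoots : ∀ {as} → All (λ a → length a ≤ 0) as → length as ≡ total isRoot as
  allRoots []                   = refl
  allRoots (_∷_ {[]} _ ps)      = cong suc (allRoots ps)
  allRoots (_∷_ {_ ∷ _} () _)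
kraft (suc h) {as} us short = begin
  3 * total (weight (suc h)) as         ≡⟨ cong (3 *_) (total-by-root (weight (suc h)) as) ⟩
  3 * (ρ * 8 ^ suc h + (tˡ + tʳ))       ≡⟨ distrib ρ (8 ^ suc h) tˡ tʳ ⟩
  ρ * (3 * 8 ^ suc h) + (3 * tˡ + 3 * tʳ)
    ≤⟨ +-mono-≤ (*-monoˡ-≤ (3 * 8 ^ suc h) (total-isRoot us)) (+-mono-≤ (child true) (child false)) ⟩
  -- The ratio 4 / 3 is the fixed point of x = 1 + 2 * x / 8: the root counts 1 and each of the two
  -- subtrees x / 8.
  1 * (3 * 8 ^ suc h) + (4 * 8 ^ h + 4 * 8 ^ h)  ≡⟨ geometric (8 ^ h) ⟩
  4 * 8 ^ suc h                          ∎
  where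
  open ≤-Reasoning
  ρ  = total isRoot as
  tˡ = total (weight h) (childAddrs true as)
  tʳ = total (weight h) (childAddrs false as)
  child : ∀ b → 3 * total (weight h) (childAddrs b as) ≤ 4 * 8 ^ h
  child b = kraft h (childAddrs-Unique b us) (childAddrs-All b (λ { (s≤s p) → p }) short)
  distrib : ∀ r x y z → 3 * (r * x + (y + z)) ≡ r * (3 * x) + (3 * y + 3 * z)
  distrib = solve-∀
  geometric : ∀ x → 1 * (3 * (8 * x)) + (4 * x + 4 * x) ≡ 4 * (8 * x)
  geometric = solve-∀

-- The invariant carried along offline swaps; it supplies the hypotheses of `kraft` for the list of
-- all offline addresses.
Embeds : ∀ {m} → ℕ → Loc m → Set
Embeds H loc = (∀ x → depth loc x ≤ H) × (∀ x y → loc x ≡ loc y → x ≡ y)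

sum-weight : ∀ {m} H (opt : Loc m) → Embeds H opt → 3 * sum (λ e → weight H (opt e)) ≤ 4 * 8 ^ H
sum-weight H opt (short , inj) = begin
  3 * sum (weight H ∘ opt)                ≡⟨ cong (3 *_) (sum-tabulate opt) ⟩
  3 * total (weight H) (tabulate opt)     ≤⟨ kraft H (Unique.tabulate⁺ (inj _ _)) (All.tabulate⁺ short) ⟩
  4 * 8 ^ H                               ∎
  where
  open ≤-Reasoning
  sum-tabulate : ∀ {m} (g : Loc m) → sum (weight H ∘ g) ≡ total (weight H) (tabulate g)
  sum-tabulate {zero}  g = refl
  sum-tabulate {suc m} g = cong (weight H (g zero) +_) (sum-tabulate (g ∘ suc))

-- The potential

-- φ k o is the credit held by an item at depth k of Random-Push and depth o of
-- the offline tree.  It vanishes for k ≤ o, so that equal trees have no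
-- potential, and also for k = 0, so that a request to an item at the root of
-- both trees is free.
φ : ℕ → ℕ → ℕ
φ zero    o = 0
φ (suc k) o = suc k + 2 ∸ 4 * o

φ-monoˡ : ∀ {k k′} o → k ≤ k′ → φ k o ≤ φ k′ o
φ-monoˡ o z≤n       = z≤n
φ-monoˡ o (s≤s k≤k′) = ∸-monoˡ-≤ (4 * o) (+-monoˡ-≤ 2 (s≤s k≤k′))

φ-antiʳ : ∀ k {o o′} → o ≤ o′ → φ k o′ ≤ φ k o
φ-antiʳ zero    o≤o′ = z≤n
φ-antiʳ (suc k) o≤o′ = ∸-monoʳ-≤ (suc k + 2) (*-monoʳ-≤ 4 o≤o′)

-- The slope of `φ` in `o` is 4, and truncation at 0 can only flatten it.
φ-raise : ∀ k o → φ k o ≤ φ k (suc o) + 4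
φ-raise zero    o = z≤n
φ-raise (suc k) o = begin
  x ∸ 4 * o              ≤⟨ m≤n+m∸n (x ∸ 4 * o) 4 ⟩
  4 + (x ∸ 4 * o ∸ 4)    ≡⟨ cong (4 +_) (∸-+-assoc x (4 * o) 4) ⟩
  4 + (x ∸ (4 * o + 4))  ≡⟨ cong (λ y → 4 + (x ∸ y)) (4*suc o) ⟩
  4 + (x ∸ 4 * suc o)    ≡⟨ +-comm 4 _ ⟩
  x ∸ 4 * suc o + 4      ∎
  where
  open ≤-Reasoning
  x = suc k + 2
  4*suc : ∀ o → 4 * o + 4 ≡ 4 * suc o
  4*suc = solve-∀

φ-lower-raise : ∀ k {o o′} → o ≤ suc o′ → φ k o′ ≤ φ k o + 4
φ-lower-raise k {o} {o′} o≤1+o′ = ≤-trans (φ-raise k o′) (+-monoˡ-≤ 4 (φ-antiʳ k o≤1+o′))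

φ-diagonal : ∀ k → φ k k ≡ 0
φ-diagonal zero    = refl
φ-diagonal (suc k) = m≤n⇒m∸n≡0 (begin
  suc k + 2                ≤⟨ m≤m+n (suc k + 2) (3 * k + 1) ⟩
  suc k + 2 + (3 * k + 1)  ≡⟨ eq k ⟩
  4 * suc k                ∎)
  where
  open ≤-Reasoning
  eq : ∀ k → suc k + 2 + (3 * k + 1) ≡ 4 * suc k
  eq = solve-∀

-- An item at depth j is pushed down with probability 2 ^ -j, so this bounds its
-- expected gain by 3 * 8 ^ -o, which is summable over the offline tree.
φ-push : ∀ j o → (φ (suc j) o ∸ φ j o) * 8 ^ o ≤ 3 * 2 ^ j
-- The jump of `φ` from 0 to 3 when the root item sinks. This case is tight and dictates the
-- constant 3.
φ-push zero    zero    = ≤-refl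
φ-push zero    (suc o) = ≤-trans (*-monoˡ-≤ (8 ^ suc o) {1 + 2 ∸ 4 * suc o} {0} (≤-reflexive (m≤n⇒m∸n≡0 3≤4*suc))) z≤n
  where
  3≤4*suc : 3 ≤ 4 * suc o
  3≤4*suc = *-mono-≤ {3} {4} (n≤1+n 3) (s≤s (z≤n {o}))
φ-push (suc j) zero    = begin
  (suc (suc j) + 2 ∸ (suc j + 2)) * 1  ≡⟨ *-identityʳ _ ⟩
  1 + (suc j + 2) ∸ (suc j + 2)        ≡⟨ m+n∸n≡m 1 (suc j + 2) ⟩
  1                                    ≤⟨ *-mono-≤ {1} {3} (s≤s z≤n) (m^n>0 2 (suc j)) ⟩
  3 * 2 ^ suc j                        ∎
  where open ≤-Reasoning
φ-push (suc j) o@(suc o′) with suc (suc j) + 2 ≤? 4 * o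
-- Even one level deeper the item holds no credit.
... | yes j+4≤4o = begin
  (φ (2 + j) o ∸ φ (suc j) o) * 8 ^ o  ≤⟨ *-monoˡ-≤ (8 ^ o) (m∸n≤m (φ (2 + j) o) (φ (suc j) o)) ⟩
  φ (2 + j) o * 8 ^ o                  ≡⟨ cong (_* 8 ^ o) (m≤n⇒m∸n≡0 j+4≤4o) ⟩
  0                                    ≤⟨ z≤n ⟩
  3 * 2 ^ suc j                        ∎
  where open ≤-Reasoning
-- The gain is at most 1, and `4 * o ≤ j + 3` gives `16 ^ o ≤ 4 * 2 ^ suc j`. The factor 4 is
-- absorbed by `4 * 8 ^ o ≤ 3 * 16 ^ o`.
... | no j+4≰4o = begin
  (φ (2 + j) o ∸ φ (suc j) o) * 8 ^ o  ≤⟨ *-monoˡ-≤ (8 ^ o) (gap (suc j + 2) (4 * o)) ⟩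
  1 * 8 ^ o                            ≡⟨ *-identityˡ (8 ^ o) ⟩
  8 ^ o                                ≤⟨ *-cancelˡ-≤ 4 4*8^o≤ ⟩
  3 * 2 ^ suc j                        ∎
  where
  open ≤-Reasoning
  gap : ∀ x y → suc x ∸ y ∸ (x ∸ y) ≤ 1
  gap x       zero    = ≤-reflexive (m+n∸n≡m 1 x)
  gap zero    (suc y) = ≤-trans (m∸n≤m (0 ∸ y) 0) (≤-trans (≤-reflexive (0∸n≡0 y)) z≤n)
  gap (suc x) (suc y) = gap x y
  -- At exponent 0 this would read 4 ≤ 3; the case `o = 0` has its own clause above.
  4*8^≤3*16^ : ∀ n → 4 * 8 ^ suc n ≤ 3 * 16 ^ suc n
  4*8^≤3*16^ zero    = m≤m+n 32 16
  4*8^≤3*16^ (suc n) = begin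
    4 * (8 * 8 ^ suc n)    ≡⟨ x*[y*z] 4 8 (8 ^ suc n) ⟩
    8 * (4 * 8 ^ suc n)    ≤⟨ *-mono-≤ {8} {16} (m≤m+n 8 8) (4*8^≤3*16^ n) ⟩
    16 * (3 * 16 ^ suc n)  ≡⟨ x*[y*z] 16 3 (16 ^ suc n) ⟩
    3 * (16 * 16 ^ suc n)  ∎
    where
    x*[y*z] : ∀ x y z → x * (y * z) ≡ y * (x * z)
    x*[y*z] = solve-∀
  4*8^o≤ : 4 * 8 ^ o ≤ 4 * (3 * 2 ^ suc j)
  4*8^o≤ = begin
    4 * 8 ^ o            ≤⟨ 4*8^≤3*16^ o′ ⟩
    3 * 16 ^ o           ≡⟨ cong (3 *_) (^-*-assoc 2 4 o) ⟩
    3 * 2 ^ (4 * o)      ≤⟨ *-monoʳ-≤ 3 (^-monoʳ-≤ 2 (≤-pred (≰⇒> j+4≰4o))) ⟩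
    3 * 2 ^ (suc j + 2)  ≡⟨ cong (3 *_) (^-distribˡ-+-* 2 (suc j) 2) ⟩
    3 * (2 ^ suc j * 4)  ≡⟨ eq (2 ^ suc j) ⟩
    4 * (3 * 2 ^ suc j)  ∎
    where
    eq : ∀ x → 3 * (x * 4) ≡ 4 * (3 * x)
    eq = solve-∀

-- k + 4 ≤ φ k o + 6 o + 3 * 8 ^ -o, multiplied by 8 ^ h.  Here 4 pays for the
-- pushed items (3 times the Kraft sum 4 / 3); for o = 0 the term 3 * 8 ^ -o = 3,
-- the share of the requested item, makes up for the absent offline cost.
φ-request : ∀ h k o → (suc k + 4) * 8 ^ h ≤ (φ (suc k) o + 6 * o) * 8 ^ h + 3 * 8 ^ (h ∸ o)
φ-request h k zero = begin
  (suc k + 4) * 8 ^ h                              ≤⟨ *-monoˡ-≤ (8 ^ h) (≤-trans (n≤1+n (suc k + 4)) (≤-reflexive (k+5 k))) ⟩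
  (suc k + 2 + 6 * 0 + 3) * 8 ^ h                  ≡⟨ *-distribʳ-+ (8 ^ h) (suc k + 2 + 6 * 0) 3 ⟩
  (suc k + 2 + 6 * 0) * 8 ^ h + 3 * 8 ^ h          ∎
  where
  open ≤-Reasoning
  k+5 : ∀ k → suc (suc k + 4) ≡ suc k + 2 + 6 * 0 + 3
  k+5 = solve-∀
φ-request h k o@(suc o′) = ≤-trans (*-monoˡ-≤ (8 ^ h) k+4≤) (m≤m+n _ _)
  where
  open ≤-Reasoning
  rearrange : ∀ x o → 4 * o + x + 2 * o ≡ x + 6 * o
  rearrange = solve-∀
  k+4≤ : suc k + 4 ≤ φ (suc k) o + 6 * o
  k+4≤ = begin
    suc k + 4                         ≡⟨ +-assoc (suc k) 2 2 ⟨
    -- Of `6 * o`, the part `4 * o` makes up for the offset in `φ`, and `2 * o` covers the remaining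
    -- 2 because `o ≥ 1`.
    suc k + 2 + 2                     ≤⟨ +-mono-≤ (m≤n+m∸n (suc k + 2) (4 * o)) (*-monoʳ-≤ 2 (s≤s (z≤n {o′}))) ⟩
    4 * o + φ (suc k) o + 2 * o       ≡⟨ rearrange (φ (suc k) o) o ⟩
    φ (suc k) o + 6 * o               ∎

Φ : ∀ {m} → Loc m → Loc m → ℕ
Φ loc opt = sum (λ e → φ (depth loc e) (depth opt e))

Φ-diagonal : ∀ {m} (loc : Loc m) → Φ loc loc ≡ 0
Φ-diagonal {m} loc = n≤0⇒n≡0 (≤-trans (sum-mono (λ e → ≤-reflexive (φ-diagonal (depth loc e)))) (≤-reflexive (sum-0 m)))

-- Offline swaps

length-∷ʳ : ∀ (p : Addr) b → length (p ∷ʳ b) ≡ suc (length p)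
length-∷ʳ p b = trans (length-++ p) (+-comm (length p) 1)

∷ʳ-≢ : ∀ (p : Addr) {b} → p ∷ʳ b ≢ p
∷ʳ-≢ p eq = 1+n≢n (trans (sym (length-∷ʳ p _)) (cong length eq))

module _ {m H : ℕ} (p : Addr) (b : Bool) (p<H : length p < H) (opt : Loc m) where

  private
    s : Swap H
    s = swap p b p<H

  applySwap-depth-≥ : ∀ e → opt e ≢ p ∷ʳ b → depth opt e ≤ depth (applySwap s opt) e
  applySwap-depth-≥ e ≢child with opt e ≟A p | opt e ≟A (p ∷ʳ b)
  ... | yes eq | _     = ≤-trans (≤-reflexive (cong length eq)) (≤-trans (n≤1+n _) (≤-reflexive (sym (length-∷ʳ p b))))
  ... | no _   | yes ≡child = contradiction ≡child ≢child
  ... | no _   | no _  = ≤-refl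

  applySwap-depth-suc-≥ : ∀ e → depth opt e ≤ suc (depth (applySwap s opt) e)
  applySwap-depth-suc-≥ e with opt e ≟A p | opt e ≟A (p ∷ʳ b)
  ... | yes eq | _      = ≤-trans (≤-reflexive (cong length eq)) (≤-trans (n≤1+n _) (≤-trans (≤-reflexive (sym (length-∷ʳ p b))) (n≤1+n _)))
  ... | no _   | yes eq = ≤-reflexive (trans (cong length eq) (length-∷ʳ p b))
  ... | no _   | no _   = n≤1+n _

  applySwap-short : (∀ e → depth opt e ≤ H) → ∀ e → depth (applySwap s opt) e ≤ H
  applySwap-short short e with opt e ≟A p | opt e ≟A (p ∷ʳ b)
  ... | yes _ | _     = ≤-trans (≤-reflexive (length-∷ʳ p b)) p<H
  ... | no _  | yes _ = <⇒≤ p<H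
  ... | no _  | no _  = short e

  applySwap-injective : (∀ x y → opt x ≡ opt y → x ≡ y) →
    ∀ x y → applySwap s opt x ≡ applySwap s opt y → x ≡ y
  applySwap-injective inj x y eq
    with opt x ≟A p | opt x ≟A (p ∷ʳ b) | opt y ≟A p | opt y ≟A (p ∷ʳ b)
  ... | yes ≡p | _      | yes ≡p′ | _       = inj x y (trans ≡p (sym ≡p′))
  ... | yes _  | _      | no _    | yes _   = contradiction eq (∷ʳ-≢ p)
  ... | yes _  | _      | no _    | no ≢c′  = contradiction (sym eq) ≢c′
  ... | no _   | yes _  | yes _   | _       = contradiction (sym eq) (∷ʳ-≢ p)
  ... | no _   | yes ≡c | no _    | yes ≡c′ = inj x y (trans ≡c (sym ≡c′))
  ... | no _   | yes _  | no ≢p′  | no _    = contradiction (sym eq) ≢p′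
  ... | no _   | no ≢c  | yes _   | _       = contradiction eq ≢c
  ... | no ≢p  | no _   | no _    | yes _   = contradiction eq ≢p
  ... | no _   | no _   | no _    | no _    = inj x y eq

  applySwap-Embeds : Embeds H opt → Embeds H (applySwap s opt)
  applySwap-Embeds (short , inj) = applySwap-short short , applySwap-injective inj

  -- Only an item at the child server is lifted, by one level, and injectivity allows at most one
  -- such item. All others stay or sink, and `φ` is antitone in the offline depth.
  Φ-applySwap : (∀ x y → opt x ≡ opt y → x ≡ y) → ∀ loc → Φ loc (applySwap s opt) ≤ Φ loc opt + 4
  Φ-applySwap inj loc with any? (λ e → opt e ≟A (p ∷ʳ b))
  ... | no none = ≤-trans (sum-mono (λ e → φ-antiʳ (depth loc e) (applySwap-depth-≥ e (λ eq → none (e , eq)))))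
                          (m≤m+n _ 4)
  ... | yes (v , v≡child) = ≤-trans (≤-reflexive (sym (+-identityʳ _)))
    (sum-mono-except v
      (λ e e≢v → φ-antiʳ (depth loc e) (applySwap-depth-≥ e (λ eq → e≢v (inj e v (trans eq (sym v≡child))))))
      (≤-trans (≤-reflexive (+-identityʳ _)) (φ-lower-raise (depth loc v) (applySwap-depth-suc-≥ v))))

applySwaps-Embeds : ∀ {m H} (ss : List (Swap H)) {opt : Loc m} → Embeds H opt → Embeds H (applySwaps ss opt)
applySwaps-Embeds []       emb = emb
applySwaps-Embeds (s@(swap p b p<H) ∷ ss) emb = applySwaps-Embeds ss (applySwap-Embeds p b p<H _ emb)

Φ-applySwaps : ∀ {m H} (ss : List (Swap H)) (loc : Loc m) {opt : Loc m} → Embeds H opt →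
  Φ loc (applySwaps ss opt) ≤ Φ loc opt + length ss * 4
Φ-applySwaps []       loc {opt} emb = ≤-reflexive (sym (+-identityʳ _))
Φ-applySwaps (s@(swap p b p<H) ∷ ss) loc {opt} emb = begin
  Φ loc (applySwaps ss (applySwap s opt))        ≤⟨ Φ-applySwaps ss loc (applySwap-Embeds p b p<H opt emb) ⟩
  Φ loc (applySwap s opt) + length ss * 4        ≤⟨ +-monoˡ-≤ _ (Φ-applySwap p b p<H opt (proj₂ emb) loc) ⟩
  Φ loc opt + 4 + length ss * 4                  ≡⟨ +-assoc (Φ loc opt) 4 _ ⟩
  Φ loc opt + (4 + length ss * 4)                ∎
  where open ≤-Reasoning

-- A step of Random-Push

pushMove′-length : ∀ s path a (d : Dec (a ≡ path)) → length path ≡ length s →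
  length (pushMove′ (length s) s path a d) ≤ length a
pushMove′-length s path a (yes a≡path) eq = ≤-reflexive (sym (trans (cong length a≡path) eq))
pushMove′-length s path a (no _)       eq = ≤-refl

-- The item at the end of the path moves sideways, since `path` and `s` have equal length, so only
-- items above it on the path can sink. Their position on the path is recorded because it is what
-- bounds the probability.
pushMove-length : ∀ s path a → length path ≡ length s →
  length (pushMove (length s) s path a) ≤ length a ⊎
  (length a < length s × length (pushMove (length s) s path a) ≤ suc (length a) × a ≡ take (length a) path)
pushMove-length s path a eq with length a <? length s | a ≟A take (length a) path
... | yes a<s | yes a≡take = inj₂ (a<s , ≤-trans (≤-reflexive (length-take (suc (length a)) path)) (m⊓n≤m _ _) , a≡take)
... | yes _   | no _       = inj₁ (pushMove′-length s path a (a ≟A path) eq)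
... | no _    | _          = inj₁ (pushMove′-length s path a (a ≟A path) eq)

module _ {m H : ℕ} (loc : Loc m) (u : Fin m) where

  rpStep-requested : ∀ r → depth (rpStep {H = H} loc u r) u ≡ 0
  rpStep-requested r with u ≟ u
  ... | yes _  = refl
  ... | no u≢u = contradiction refl u≢u

  -- For `j < k` the first `j` steps of the path are the first `j` bits of `r`. Sinking thus implies
  -- an event about the whole vector `r`, whose frequency `total-visits` bounds independently of
  -- `k`.
  rpStep-depth : depth loc u ≤ H → ∀ (r : Vec Bool H) e → e ≢ u →
    depth (rpStep loc u r) e ≤ depth loc e ⊎
    (depth loc e < depth loc u × depth (rpStep loc u r) e ≤ suc (depth loc e) × visits (loc e) r ≡ 1)
  rpStep-depth k≤H r e e≢u with e ≟ u
  ... | yes e≡u = contradiction e≡u e≢u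
  ... | no _ with pushMove-length (loc u) (take (depth loc u) (toList r)) (loc e) path-length
    where
    path-length : length (take (depth loc u) (toList r)) ≡ depth loc u
    path-length = trans (length-take (depth loc u) (toList r))
      (m≤n⇒m⊓n≡m (≤-trans k≤H (≤-reflexive (sym (Vec.length-toList r)))))
  ...   | inj₁ stays = inj₁ stays
  ...   | inj₂ (j<k , ≤1+j , onPath) = inj₂ (j<k , ≤1+j , visits-take (loc e) r
            (trans onPath (trans (take-take (depth loc e) (depth loc u) (toList r))
                                 (cong (λ i → take i (toList r)) (m≤n⇒m⊓n≡m (<⇒≤ j<k))))))

  rpStep-short : (∀ e → depth loc e ≤ H) → ∀ (r : Vec Bool H) e → depth (rpStep loc u r) e ≤ H
  rpStep-short short r e = bound (e ≟ u)
    where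
    bound : Dec (e ≡ u) → depth (rpStep loc u r) e ≤ H
    bound (yes refl) = ≤-trans (≤-reflexive (rpStep-requested r)) z≤n
    bound (no e≢u) with rpStep-depth (short u) r e e≢u
    ... | inj₁ ≤j             = ≤-trans ≤j (short e)
    -- Sinking starts strictly above the depth of `u`, so the item stays in the tree.
    ... | inj₂ (j<k , ≤1+j , _) = ≤-trans ≤1+j (≤-trans j<k (short u))

  module _ (short : ∀ e → depth loc e ≤ H) where

    private
      R = allVecs bits H
      N = length R

    -- `N` times the expected credit of `e` after the push.
    credit : Fin m → ℕ → ℕ
    credit e o = total (λ r → φ (depth (rpStep loc u r) e) o) R

    credit-requested : ∀ o → credit u o ≡ 0
    credit-requested o = begin
      credit u o         ≡⟨ total-cong (λ r → cong (λ k → φ k o) (rpStep-requested r)) R ⟩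
      total (const 0) R  ≡⟨ total-const 0 R ⟩
      N * 0              ≡⟨ *-zeroʳ N ⟩
      0                  ∎
      where open ≡-Reasoning

    -- The path is empty, so nothing sinks. This case stands apart because `φ` is 0 at the root and
    -- could not pay the constant 4 of `φ-request`.
    credit-root : depth loc u ≡ 0 → ∀ e o → e ≢ u → credit e o ≤ N * φ (depth loc e) o
    credit-root k≡0 e o e≢u = ≤-trans (total-mono stays R) (≤-reflexive (total-const _ R))
      where
      stays : ∀ r → φ (depth (rpStep loc u r) e) o ≤ φ (depth loc e) o
      stays r with rpStep-depth (short u) r e e≢u
      ... | inj₁ ≤j        = φ-monoˡ o ≤j
      ... | inj₂ (j<k , _) = contradiction (subst (depth loc e <_) k≡0 j<k) λ ()

    -- The item sinks with probability at most 2 ^ -j and then gains at most `d`; `φ-push` bounds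
    -- the product by 3 * 8 ^ -o.
    credit-other : ∀ e o → e ≢ u → credit e o * 8 ^ o ≤ N * φ (depth loc e) o * 8 ^ o + 3 * N
    credit-other e o e≢u = begin
      credit e o * 8 ^ o                             ≤⟨ *-monoˡ-≤ (8 ^ o) credit≤ ⟩
      (N * φ j o + t * d) * 8 ^ o                    ≡⟨ *-distribʳ-+ (8 ^ o) (N * φ j o) (t * d) ⟩
      N * φ j o * 8 ^ o + t * d * 8 ^ o              ≡⟨ cong (N * φ j o * 8 ^ o +_) (*-assoc t d (8 ^ o)) ⟩
      N * φ j o * 8 ^ o + t * (d * 8 ^ o)            ≤⟨ +-monoʳ-≤ (N * φ j o * 8 ^ o) (*-monoʳ-≤ t (φ-push j o)) ⟩
      N * φ j o * 8 ^ o + t * (3 * 2 ^ j)            ≡⟨ cong (N * φ j o * 8 ^ o +_) (x*[3*y] t (2 ^ j)) ⟩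
      N * φ j o * 8 ^ o + 3 * (t * 2 ^ j)            ≤⟨ +-monoʳ-≤ (N * φ j o * 8 ^ o) (*-monoʳ-≤ 3 (total-visits (loc e) H)) ⟩
      N * φ j o * 8 ^ o + 3 * N                      ∎
      where
      open ≤-Reasoning
      j = depth loc e
      d = φ (suc j) o ∸ φ j o
      t = total (visits (loc e)) R
      x*[3*y] : ∀ x y → x * (3 * y) ≡ 3 * (x * y)
      x*[3*y] = solve-∀
      moves : ∀ r → φ (depth (rpStep loc u r) e) o ≤ φ j o + visits (loc e) r * d
      moves r with rpStep-depth (short u) r e e≢u
      ... | inj₁ ≤j = ≤-trans (φ-monoˡ o ≤j) (m≤m+n _ _)
      ... | inj₂ (_ , ≤1+j , visited) rewrite visited | *-identityˡ d = ≤-trans (φ-monoˡ o ≤1+j) (m≤n+m∸n _ (φ j o))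
      credit≤ : credit e o ≤ N * φ j o + t * d
      credit≤ = begin
        credit e o                                          ≤⟨ total-mono moves R ⟩
        total (λ r → φ j o + visits (loc e) r * d) R        ≡⟨ total-+ (const (φ j o)) _ R ⟩
        total (const (φ j o)) R + total (λ r → visits (loc e) r * d) R
          ≡⟨ cong₂ _+_ (total-const (φ j o) R) (total-* (visits (loc e)) d R) ⟩
        N * φ j o + t * d                                   ∎

    -- Brings `credit-other` to the common denominator `8 ^ H`, so that items of different offline
    -- depths can be summed.
    credit-other-weight : ∀ e (a : Addr) → length a ≤ H → e ≢ u →
      8 ^ H * credit e (length a) ≤ N * 8 ^ H * φ (depth loc e) (length a) + 3 * N * weight H a
    credit-other-weight e a a≤H e≢u = begin
      8 ^ H * credit e o                                  ≡⟨ cong (_* credit e o) 8^H ⟩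
      8 ^ o * w * credit e o                              ≡⟨ eq₁ (8 ^ o) w (credit e o) ⟩
      credit e o * 8 ^ o * w                              ≤⟨ *-monoˡ-≤ w (credit-other e o e≢u) ⟩
      (N * φ j o * 8 ^ o + 3 * N) * w                     ≡⟨ eq₂ N (φ j o) (8 ^ o) w ⟩
      N * (8 ^ o * w) * φ j o + 3 * N * w                 ≡⟨ cong (λ x → N * x * φ j o + 3 * N * w) 8^H ⟨
      N * 8 ^ H * φ j o + 3 * N * w                       ∎
      where
      open ≤-Reasoning
      o = length a
      j = depth loc e
      w = weight H a
      8^H : 8 ^ H ≡ 8 ^ o * w
      8^H = trans (cong (8 ^_) (sym (m+[n∸m]≡n a≤H))) (^-distribˡ-+-* 8 o (H ∸ o))
      eq₁ : ∀ x y z → x * y * z ≡ z * x * y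
      eq₁ = solve-∀
      eq₂ : ∀ n x y z → (n * x * y + 3 * n) * z ≡ n * (y * z) * x + 3 * n * z
      eq₂ = solve-∀

    -- In expectation the other items gain at most 3 * 4 / 3 = 4. By `φ-request`, the credit given
    -- up by `u`, together with 6 times its offline depth, covers this 4 and the access depth.
    amortized : ∀ opt → Embeds H opt →
      total (λ r → Φ (rpStep loc u r) opt) R + N * depth loc u ≤ N * (Φ loc opt + 6 * depth opt u)
    amortized opt (optShort , optInj) = ≤-trans
      (≤-reflexive (cong (_+ N * depth loc u) (total-sum (λ r e → φ (depth (rpStep loc u r) e) (depth opt e)) R)))
      (byDepth (depth loc u) refl)
      where
      open ≤-Reasoning
      o = depth opt u
      T = sum (λ e → credit e (depth opt e))
      φs ws : Fin m → ℕ
      φs e = φ (depth loc e) (depth opt e)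
      ws e = weight H (opt e)
      byDepth : ∀ k → depth loc u ≡ k → T + N * depth loc u ≤ N * (Φ loc opt + 6 * o)
      byDepth zero k≡0 = begin
        T + N * depth loc u                                  ≡⟨ cong (λ k → T + N * k) k≡0 ⟩
        T + N * 0                                            ≡⟨ cong (T +_) (*-zeroʳ N) ⟩
        T + 0                                                ≤⟨ sum-mono-except u (λ e → credit-root k≡0 e (depth opt e)) requested ⟩
        sum (λ e → N * φs e) + 0    ≡⟨ +-identityʳ _ ⟩
        sum (λ e → N * φs e)        ≡⟨ *-distribˡ-sum N φs ⟨
        N * Φ loc opt                                        ≤⟨ *-monoʳ-≤ N (m≤m+n _ _) ⟩
        N * (Φ loc opt + 6 * o)                              ∎
        where
        requested : credit u o + 0 ≤ N * φ (depth loc u) o + 0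
        requested = +-monoˡ-≤ 0 (≤-trans (≤-reflexive (credit-requested o)) z≤n)
      -- Scaled by `P`, the constant 4 is added on both sides: on the left it joins the bill of `u`,
      -- on the right it dominates the Kraft sum over all items, including the share of `u` itself
      -- that `φ-request` uses.
      byDepth (suc k′) k≡ = *-cancelˡ-≤ P {{m^n≢0 8 H}} (+-cancelʳ-≤ (N * (4 * P)) _ _ (begin
        P * (T + N * k) + N * (4 * P)                        ≡⟨ eq₁ P T N k ⟩
        P * T + N * ((k + 4) * P)                            ≡⟨ cong (_+ N * ((k + 4) * P)) (*-distribˡ-sum P (λ e → credit e (depth opt e))) ⟩
        sum (λ e → P * credit e (depth opt e)) + N * ((k + 4) * P)
          ≤⟨ sum-mono-except u (λ e → credit-other-weight e (opt e) (optShort e)) requested ⟩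
        sum (λ e → N * P * φs e + 3 * N * ws e) + N * (6 * o * P)
          ≡⟨ cong (_+ N * (6 * o * P)) (trans (∑-distrib-+ (λ e → N * P * φs e) (λ e → 3 * N * ws e))
                                             (sym (cong₂ _+_ (*-distribˡ-sum (N * P) φs) (*-distribˡ-sum (3 * N) ws)))) ⟩
        N * P * Φ loc opt + 3 * N * W + N * (6 * o * P)      ≡⟨ eq₂ N P (Φ loc opt) W o ⟩
        P * (N * (Φ loc opt + 6 * o)) + N * (3 * W)          ≤⟨ +-monoʳ-≤ (P * (N * (Φ loc opt + 6 * o))) (*-monoʳ-≤ N (sum-weight H opt (optShort , optInj))) ⟩
        P * (N * (Φ loc opt + 6 * o)) + N * (4 * P)          ∎))
        where
        k = depth loc u
        P = 8 ^ H
        W = sum ws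
        eq₁ : ∀ p t n k → p * (t + n * k) + n * (4 * p) ≡ p * t + n * ((k + 4) * p)
        eq₁ = solve-∀
        eq₂ : ∀ n p x w o → n * p * x + 3 * n * w + n * (6 * o * p) ≡ p * (n * (x + 6 * o)) + n * (3 * w)
        eq₂ = solve-∀
        eq₃ : ∀ n p x o w → n * ((x + 6 * o) * p + 3 * w) ≡ n * p * x + 3 * n * w + n * (6 * o * p)
        eq₃ = solve-∀
        requested : P * credit u o + N * ((k + 4) * P) ≤ N * P * φ k o + 3 * N * weight H (opt u) + N * (6 * o * P)
        requested = begin
          P * credit u o + N * ((k + 4) * P)                      ≡⟨ cong (λ x → P * x + N * ((k + 4) * P)) (credit-requested o) ⟩
          P * 0 + N * ((k + 4) * P)                               ≡⟨ cong (_+ N * ((k + 4) * P)) (*-zeroʳ P) ⟩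
          N * ((k + 4) * P)                                       ≤⟨ *-monoʳ-≤ N requestBound ⟩
          N * ((φ k o + 6 * o) * P + 3 * weight H (opt u))        ≡⟨ eq₃ N P (φ k o) o _ ⟩
          N * P * φ k o + 3 * N * weight H (opt u) + N * (6 * o * P)  ∎
          where
          requestBound : (k + 4) * P ≤ (φ k o + 6 * o) * P + 3 * weight H (opt u)
          requestBound rewrite k≡ = φ-request H k′ o

-- Amortization over the request sequence

-- A request at depth `k` costs `5 * k`, hence the factor 5 on the potential. An offline access then
-- costs 5 * 6 = 30 per level and an offline swap 5 * 4 = 20, which 30 covers.
rpTotal-bound : ∀ {m} H (loc opt : Loc m) → (∀ e → depth loc e ≤ H) → Embeds H opt →
  (σ : List (Fin m)) (moves : Vec (List (Swap H)) (length σ)) →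
  rpTotal H loc σ ≤ (5 * Φ loc opt + 30 * offCost opt σ moves) * length (outcomes H (length σ))
rpTotal-bound H loc opt short emb []      []             = z≤n
rpTotal-bound H loc opt short emb (u ∷ σ) (ss ∷ moves) = begin
  rpTotal H loc (u ∷ σ)
    ≡⟨ total-allVecs R (length σ) (rpCost H loc (u ∷ σ)) ⟩
  total (λ r → total (λ rs → k + 4 * k + rpCost H (rpStep loc u r) σ rs) Ω) R
    ≡⟨ total-cong (λ r → trans (total-+ (const (k + 4 * k)) _ Ω) (cong (_+ rpTotal H (rpStep loc u r) σ) (total-const _ Ω))) R ⟩
  total (λ r → M * (k + 4 * k) + rpTotal H (rpStep loc u r) σ) R
    -- The induction hypothesis is used for each `r` with the same `σ` and `moves`: the adversary is
    -- oblivious.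
    ≤⟨ total-mono (λ r → +-monoʳ-≤ (M * (k + 4 * k))
         (rpTotal-bound H (rpStep loc u r) opt′ (rpStep-short loc u short r) emb′ σ moves)) R ⟩
  total (λ r → M * (k + 4 * k) + (5 * Φ (rpStep loc u r) opt′ + 30 * c) * M) R
    ≡⟨ total-cong (λ r → eq₁ M k (Φ (rpStep loc u r) opt′) c) R ⟩
  total (λ r → M * (5 * k + 30 * c) + Φ (rpStep loc u r) opt′ * (5 * M)) R
    ≡⟨ trans (total-+ (const (M * (5 * k + 30 * c))) _ R)
             (cong₂ _+_ (total-const (M * (5 * k + 30 * c)) R) (total-* (λ r → Φ (rpStep loc u r) opt′) (5 * M) R)) ⟩
  N * (M * (5 * k + 30 * c)) + T * (5 * M)
    ≡⟨ eq₂ N M k c T ⟩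
  5 * M * (T + N * k) + 30 * c * (N * M)
    ≤⟨ +-monoˡ-≤ _ (*-monoʳ-≤ (5 * M) (amortized loc u short opt′ emb′)) ⟩
  5 * M * (N * (Φ loc opt′ + 6 * o)) + 30 * c * (N * M)
    ≤⟨ +-monoˡ-≤ _ (*-monoʳ-≤ (5 * M) (*-monoʳ-≤ N (+-monoˡ-≤ (6 * o) (Φ-applySwaps ss loc emb)))) ⟩
  5 * M * (N * (Φ loc opt + length ss * 4 + 6 * o)) + 30 * c * (N * M)
    -- Rounds the 20 per swap up to 30.
    ≤⟨ m≤m+n _ (10 * length ss * (N * M)) ⟩
  5 * M * (N * (Φ loc opt + length ss * 4 + 6 * o)) + 30 * c * (N * M) + 10 * length ss * (N * M)
    ≡⟨ eq₃ M N (Φ loc opt) (length ss) o c ⟩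
  (5 * Φ loc opt + 30 * (length ss + o + c)) * (N * M)
    ≡⟨ cong ((5 * Φ loc opt + 30 * (length ss + o + c)) *_) (length-allVecs R (length σ)) ⟨
  (5 * Φ loc opt + 30 * (length ss + o + c)) * length (outcomes H (suc (length σ)))  ∎
  where
  open ≤-Reasoning
  R    = allVecs bits H
  N    = length R
  Ω    = outcomes H (length σ)
  M    = length Ω
  k    = depth loc u
  opt′ = applySwaps ss opt
  emb′ = applySwaps-Embeds ss emb
  o    = depth opt′ u
  c    = offCost opt′ σ moves
  T    = total (λ r → Φ (rpStep loc u r) opt′) R
  eq₁ : ∀ m k x c → m * (k + 4 * k) + (5 * x + 30 * c) * m ≡ m * (5 * k + 30 * c) + x * (5 * m)
  eq₁ = solve-∀
  eq₂ : ∀ n m k c t → n * (m * (5 * k + 30 * c)) + t * (5 * m) ≡ 5 * m * (t + n * k) + 30 * c * (n * m)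
  eq₂ = solve-∀
  eq₃ : ∀ m n x s o c → 5 * m * (n * (x + s * 4 + 6 * o)) + 30 * c * (n * m) + 10 * s * (n * m) ≡
                        (5 * x + 30 * (s + o + c)) * (n * m)
  eq₃ = solve-∀

theorem3 : ∃[ c ] ∀ (H m : ℕ) (loc : Loc m) → IsPlacement H loc →
    (σ : List (Fin m)) (opt : Vec (List (Swap H)) (length σ)) →
    rpTotal H loc σ ≤ c * offCost loc σ opt * length (outcomes H (length σ))
theorem3 = 30 , λ H m loc (short , inj , _) σ opt →
  -- Both algorithms start from `loc`, so the initial potential is 0 and no additive term remains.
  subst (λ x → rpTotal H loc σ ≤ (5 * x + 30 * offCost loc σ opt) * length (outcomes H (length σ)))
    (Φ-diagonal loc) (rpTotal-bound H loc loc short (short , inj) σ opt)
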